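{- Let $(x_n)_{n=1}^{\infty}$ be a sequence on $[0,1]$ and assume that for all $s \in \mathbb{N}$ (positive integers) $$ \lim_{N \rightarrow \infty} \frac{1}{N} \# \left\{ (m,n): 1 \leq m \neq n \leq N,\ |x_m - x_n| \leq \frac{s}{N} \right\} = 2s.$$ Then the sequence $(x_n)_{n=1}^\infty$ is uniformly distributed on $[0,1]$.
   Context: The count is over ordered pairs $(m,n)$ with $m\ne n$. A sequence on $[0,1]$ is uniformly distributed if for every interval $J\subset[0,1]$, $\lim_{N\to\infty}\frac1N\#\{1\le i\le N: x_i\in J\}=|J|$, where $|J|$ is the length of $J$. -}

module Defs where

open import Axiom.ExcludedMiddle using (ExcludedMiddle)
open import Data.Fin.Base using (Fin; toℕ)
open import Data.Integer.Base using (+_)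
open import Data.List.Base using (List; length; filter; allFin; cartesianProduct)
open import Data.Nat.Base as ℕ using (ℕ; NonZero)
import Data.Nat.Properties as ℕ
open import Data.Product.Base using (Σ-syntax; ∃-syntax; _×_; _,_)
open import Data.Rational.Base as ℚ using (ℚ; 0ℚ; 1ℚ; ½)
import Data.Rational.Properties as ℚ
open import Data.Rational.Solver using (module +-*-Solver)
open import Data.Sum.Base using (inj₁; inj₂)
open import Level using (0ℓ)
open import Relation.Binary.PropositionalEquality using (_≡_; _≢_; refl; sym; trans; cong; subst)

------------------------------------------------------------------------
-- Real numbers, represented by Cauchy sequences of rationals.  Equality of
-- reals is "x ≤ y and y ≤ x", not propositional equality; all the relations
-- and operations below respect it.

IsCauchy : (ℕ → ℚ) → Set
IsCauchy u = ∀ ε → 0ℚ ℚ.< ε → ∃[ k ] ∀ m n → k ℕ.≤ m → k ℕ.≤ n → ℚ.∣ u m ℚ.- u n ∣ ℚ.< ε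

record ℝ : Set where
  constructor mkℝ
  field
    seq    : ℕ → ℚ
    cauchy : IsCauchy seq

open ℝ public

infix 4 _<_ _≤_
infixl 6 _-_

_<_ : ℝ → ℝ → Set
x < y = Σ[ ε ∈ ℚ ] 0ℚ ℚ.< ε × ∃[ k ] ∀ n → k ℕ.≤ n → seq x n ℚ.+ ε ℚ.≤ seq y n

_≤_ : ℝ → ℝ → Set
x ≤ y = ∀ ε → 0ℚ ℚ.< ε → ∃[ k ] ∀ n → k ℕ.≤ n → seq x n ℚ.≤ seq y n ℚ.+ ε

fromℚ : ℚ → ℝ
fromℚ q = mkℝ (λ _ → q) λ ε ε>0 →
  0 , λ _ _ _ _ → subst (ℚ._< ε) (cong ℚ.∣_∣ (sym (ℚ.+-inverseʳ q))) ε>0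

0ℝ 1ℝ : ℝ
0ℝ = fromℚ 0ℚ
1ℝ = fromℚ 1ℚ

private
  half>0 : ∀ {ε} → 0ℚ ℚ.< ε → 0ℚ ℚ.< ½ ℚ.* ε
  half>0 {ε} ε>0 = subst (ℚ._< ½ ℚ.* ε) (ℚ.*-zeroʳ ½) (ℚ.*-monoʳ-<-pos ½ ε>0)

  half+half : ∀ ε → ½ ℚ.* ε ℚ.+ ½ ℚ.* ε ≡ ε
  half+half ε = trans (sym (ℚ.*-distribʳ-+ ε ½ ½)) (ℚ.*-identityˡ ε)

  interchange : ∀ a b c d → (a ℚ.- b) ℚ.- (c ℚ.- d) ≡ (a ℚ.- c) ℚ.- (b ℚ.- d)
  interchange = solve 4 (λ a b c d → (a :- b) :- (c :- d) := (a :- c) :- (b :- d)) refl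
    where open +-*-Solver

  ∣p∣-∣q∣≤∣p-q∣ : ∀ p q → ℚ.∣ p ∣ ℚ.- ℚ.∣ q ∣ ℚ.≤ ℚ.∣ p ℚ.- q ∣
  ∣p∣-∣q∣≤∣p-q∣ p q = begin
    ℚ.∣ p ∣ ℚ.- ℚ.∣ q ∣                       ≡⟨ cong (λ t → ℚ.∣ t ∣ ℚ.- ℚ.∣ q ∣) (lemma₁ p q) ⟩
    ℚ.∣ (p ℚ.- q) ℚ.+ q ∣ ℚ.- ℚ.∣ q ∣         ≤⟨ ℚ.+-monoˡ-≤ (ℚ.- ℚ.∣ q ∣) (ℚ.∣p+q∣≤∣p∣+∣q∣ (p ℚ.- q) q) ⟩
    (ℚ.∣ p ℚ.- q ∣ ℚ.+ ℚ.∣ q ∣) ℚ.- ℚ.∣ q ∣   ≡⟨ lemma₂ ℚ.∣ p ℚ.- q ∣ ℚ.∣ q ∣ ⟩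
    ℚ.∣ p ℚ.- q ∣                             ∎
    where
    open ℚ.≤-Reasoning
    open +-*-Solver
    lemma₁ : ∀ a b → a ≡ (a ℚ.- b) ℚ.+ b
    lemma₁ = solve 2 (λ a b → a := (a :- b) :+ b) refl
    lemma₂ : ∀ a b → (a ℚ.+ b) ℚ.- b ≡ a
    lemma₂ = solve 2 (λ a b → (a :+ b) :- b := a) refl

  neg-minus : ∀ p q → ℚ.- (p ℚ.- q) ≡ q ℚ.- p
  neg-minus = solve 2 (λ a b → :- (a :- b) := b :- a) refl
    where open +-*-Solver

  ∣∣p∣-∣q∣∣≤∣p-q∣ : ∀ p q → ℚ.∣ ℚ.∣ p ∣ ℚ.- ℚ.∣ q ∣ ∣ ℚ.≤ ℚ.∣ p ℚ.- q ∣
  ∣∣p∣-∣q∣∣≤∣p-q∣ p q with ℚ.∣p∣≡p∨∣p∣≡-p (ℚ.∣ p ∣ ℚ.- ℚ.∣ q ∣)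
  ... | inj₁ eq = subst (ℚ._≤ ℚ.∣ p ℚ.- q ∣) (sym eq) (∣p∣-∣q∣≤∣p-q∣ p q)
  ... | inj₂ eq = begin
    ℚ.∣ ℚ.∣ p ∣ ℚ.- ℚ.∣ q ∣ ∣   ≡⟨ eq ⟩
    ℚ.- (ℚ.∣ p ∣ ℚ.- ℚ.∣ q ∣)   ≡⟨ neg-minus ℚ.∣ p ∣ ℚ.∣ q ∣ ⟩
    ℚ.∣ q ∣ ℚ.- ℚ.∣ p ∣         ≤⟨ ∣p∣-∣q∣≤∣p-q∣ q p ⟩
    ℚ.∣ q ℚ.- p ∣               ≡⟨ cong ℚ.∣_∣ (neg-minus p q) ⟨
    ℚ.∣ ℚ.- (p ℚ.- q) ∣         ≡⟨ ℚ.∣-p∣≡∣p∣ (p ℚ.- q) ⟩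
    ℚ.∣ p ℚ.- q ∣               ∎
    where open ℚ.≤-Reasoning

_-_ : ℝ → ℝ → ℝ
x - y = mkℝ (λ n → seq x n ℚ.- seq y n) isCauchy
  where
  isCauchy : IsCauchy (λ n → seq x n ℚ.- seq y n)
  isCauchy ε ε>0 with cauchy x (½ ℚ.* ε) (half>0 ε>0) | cauchy y (½ ℚ.* ε) (half>0 ε>0)
  ... | k , hx | l , hy = k ℕ.⊔ l , λ m n km kn → begin-strict
    ℚ.∣ (seq x m ℚ.- seq y m) ℚ.- (seq x n ℚ.- seq y n) ∣
      ≡⟨ cong ℚ.∣_∣ (interchange (seq x m) (seq y m) (seq x n) (seq y n)) ⟩
    ℚ.∣ (seq x m ℚ.- seq x n) ℚ.- (seq y m ℚ.- seq y n) ∣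
      ≤⟨ ℚ.∣p-q∣≤∣p∣+∣q∣ (seq x m ℚ.- seq x n) (seq y m ℚ.- seq y n) ⟩
    ℚ.∣ seq x m ℚ.- seq x n ∣ ℚ.+ ℚ.∣ seq y m ℚ.- seq y n ∣
      <⟨ ℚ.+-mono-< (hx m n (ℕ.m⊔n≤o⇒m≤o k l km) (ℕ.m⊔n≤o⇒m≤o k l kn))
                    (hy m n (ℕ.m⊔n≤o⇒n≤o k l km) (ℕ.m⊔n≤o⇒n≤o k l kn)) ⟩
    ½ ℚ.* ε ℚ.+ ½ ℚ.* ε
      ≡⟨ half+half ε ⟩
    ε ∎
    where open ℚ.≤-Reasoning

∣_∣ : ℝ → ℝ
∣ x ∣ = mkℝ (λ n → ℚ.∣ seq x n ∣) λ ε ε>0 →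
  let (k , hx) = cauchy x ε ε>0 in
  k , λ m n km kn → ℚ.≤-<-trans (∣∣p∣-∣q∣∣≤∣p-q∣ (seq x m) (seq x n)) (hx m n km kn)

------------------------------------------------------------------------
-- Limits of real sequences indexed by the positive integers

Lim : ((N : ℕ) .{{_ : NonZero N}} → ℝ) → ℝ → Set
Lim a L = ∀ ε → 0ℝ < ε → ∃[ N₀ ] ∀ N .{{_ : NonZero N}} → N₀ ℕ.≤ N → ∣ a N - L ∣ < ε

------------------------------------------------------------------------
-- Intervals contained in [0,1]

data EndKind : Set where
  closedEnd openEnd : EndKind

-- `s ≤[ k ] t` is the condition that an endpoint of kind k imposes.
_≤[_]_ : ℝ → EndKind → ℝ → Set
s ≤[ closedEnd ] t = s ≤ t
s ≤[ openEnd   ] t = s < t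

record Interval : Set where
  field
    left right         : ℝ
    leftKind rightKind : EndKind
    0≤left             : 0ℝ ≤ left
    left≤right         : left ≤ right
    right≤1            : right ≤ 1ℝ

  len : ℝ
  len = right - left

open Interval public using (len)

_∈_ : ℝ → Interval → Set
t ∈ J = (left ≤[ leftKind ] t) × (t ≤[ rightKind ] right)
  where open Interval J

------------------------------------------------------------------------
-- Counting.  The order on ℝ is not constructively decidable, so the number
-- of elements satisfying a condition on reals is obtained from excluded middle.

-- The lists below enumerate their type without repetition.
count : ExcludedMiddle 0ℓ → {A : Set} → (A → Set) → List A → ℕ
count em P xs = length (filter (λ a → em {P a}) xs)

-- A sequence x₁, x₂, … is a function x : ℕ → ℝ with xₙ₊₁ = x n, so the indices
-- 1 , … , N correspond to Fin N.

-- #{ (m , n) : 1 ≤ m ≠ n ≤ N , ∣ x_m − x_n ∣ ≤ δ }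
#closePairs : ExcludedMiddle 0ℓ → (ℕ → ℝ) → ℕ → ℝ → ℕ
#closePairs em x N δ =
  count em (λ (i , j) → i ≢ j × ∣ x (toℕ i) - x (toℕ j) ∣ ≤ δ)
           (cartesianProduct (allFin N) (allFin N))

-- #{ 1 ≤ i ≤ N : x_i ∈ J }
#visits : ExcludedMiddle 0ℓ → (ℕ → ℝ) → ℕ → Interval → ℕ
#visits em x N J = count em (λ i → x (toℕ i) ∈ J) (allFin N)

UniformlyDistributed : ExcludedMiddle 0ℓ → (ℕ → ℝ) → Set
UniformlyDistributed em x =
  ∀ (J : Interval) → Lim (λ N → fromℚ (+ #visits em x N J ℚ./ N)) (len J)

{-# OPTIONS --safe #-}
-- Let kᵢ = ⌊N xᵢ⌋ and let f(t) be the number of i ≤ N with kᵢ ≤ t < kᵢ + S, for 0 ≤ t < N + S.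
-- Then Σ f = N S, and Σ f² is the sum over all pairs (i , j) of the overlap (S − |kᵢ − kⱼ|)⁺,
-- which is at most N S plus the number of close pairs at distance s/N summed over s ≤ S.
-- As these numbers are eventually at most N (2s + 1), Σ f² ≤ N (S² + 3S): f has mean about S
-- and variance only O(S).  Hence the sum of f over an interval of t, which is about S times the
-- number of points in it, is close to S times its length.  With S = l² and N ≥ l⁴ the
-- resulting error in the proportion of points is at most 5/l.
module Submission where

open import Defs
open import Axiom.ExcludedMiddle using (ExcludedMiddle)
open import Data.Bool.Base using (if_then_else_)
open import Data.Empty using (⊥-elim)
open import Data.Fin.Base using (Fin; zero; suc; toℕ)
import Data.Fin.Properties as Fin
open import Data.Integer.Base as ℤ using (+_; +[1+_])
import Data.Integer.Properties as ℤ
open import Data.List.Base using (length; filter; map; tabulate; cartesianProduct)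
open import Data.List.Properties using (filter-++; length-++; map-tabulate)
open import Data.Nat.Base as ℕ using (ℕ; NonZero; zero; suc; _+_; _*_; _∸_; z≤n; s≤s)
import Data.Nat.Properties as ℕ
open import Data.Nat.Tactic.RingSolver using (solve-∀)
open import Data.Product.Base using (Σ-syntax; ∃-syntax; _×_; _,_; proj₁; proj₂)
open import Data.Rational.Base as ℚ using (ℚ; mkℚ; _/_; 0ℚ; 1ℚ; ½; toℚᵘ)
import Data.Rational.Properties as ℚ
import Data.Rational.Solver as ℚ
import Data.Rational.Unnormalised.Base as ℚᵘ
import Data.Rational.Unnormalised.Properties as ℚᵘ
open import Data.Sum.Base using (_⊎_; inj₁; inj₂)
open import Function.Base using (_∘_; id)
open import Level using (0ℓ)
open import Relation.Binary.PropositionalEquality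
  using (_≡_; _≢_; refl; sym; trans; cong; cong₂; subst; subst₂; module ≡-Reasoning)
open import Relation.Nullary using (Dec; yes; no; does; ¬_; ¬?; _×-dec_)
open import Algebra.Properties.Semiring.Sum ℕ.+-*-semiring
  using (sum; sum-syntax; sum-cong-≗; ∑-distrib-+; ∑-comm; *-distribˡ-sum; *-distribʳ-sum)

-- Sums and indicators

sum-mono-≤ : ∀ {n} {f g : Fin n → ℕ} → (∀ i → f i ℕ.≤ g i) → sum f ℕ.≤ sum g
sum-mono-≤ {zero}  f≤g = z≤n
sum-mono-≤ {suc n} f≤g = ℕ.+-mono-≤ (f≤g zero) (sum-mono-≤ (λ i → f≤g (suc i)))

sum-const : ∀ n c → ∑[ i < n ] c ≡ n * c
sum-const zero    c = refl
sum-const (suc n) c = cong (c ℕ.+_) (sum-const n c)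

sum-toℕ-+ : ∀ m n (g : ℕ → ℕ) →
  ∑[ i < m + n ] g (toℕ i) ≡ ∑[ i < m ] g (toℕ i) + ∑[ i < n ] g (m + toℕ i)
sum-toℕ-+ zero    n g = refl
sum-toℕ-+ (suc m) n g =
  trans (cong (g 0 ℕ.+_) (sum-toℕ-+ m n (λ t → g (suc t)))) (sym (ℕ.+-assoc (g 0) _ _))

-- The offset `c` is kept general for the induction. With `c = 1` this evaluates the sum of 2s + 1
-- over 1 ≤ s ≤ S, the eventual bounds on the close pairs divided by N.
sum-odd : ∀ n c → ∑[ r < n ] (2 * (c + toℕ r) + 1) ≡ n * n + 2 * (c * n)
sum-odd zero    c = sym (cong (2 *_) (ℕ.*-zeroʳ c))
sum-odd (suc n) c = trans
  (cong (2 * (c + 0) + 1 ℕ.+_) (trans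
    (sum-cong-≗ {n} (λ r → cong (λ u → 2 * u + 1) (ℕ.+-suc c (toℕ r))))
    (sum-odd n (suc c))))
  (arith n c)
  where
  arith : ∀ n c → 2 * (c + 0) + 1 + (n * n + 2 * ((1 + c) * n)) ≡ (1 + n) * (1 + n) + 2 * (c * (1 + n))
  arith = solve-∀

⟦_⟧ : ∀ {P : Set} → Dec P → ℕ
⟦ P? ⟧ = if does P? then 1 else 0

⟦⟧-yes : ∀ {P : Set} (P? : Dec P) → P → ⟦ P? ⟧ ≡ 1
⟦⟧-yes (yes _) p = refl
⟦⟧-yes (no ¬p) p = ⊥-elim (¬p p)

⟦⟧-no : ∀ {P : Set} (P? : Dec P) → ¬ P → ⟦ P? ⟧ ≡ 0
⟦⟧-no (yes p) ¬p = ⊥-elim (¬p p)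
⟦⟧-no (no _)  ¬p = refl

⟦⟧≤1 : ∀ {P : Set} (P? : Dec P) → ⟦ P? ⟧ ℕ.≤ 1
⟦⟧≤1 (yes _) = ℕ.≤-refl
⟦⟧≤1 (no _)  = z≤n

⟦⟧-mono : ∀ {P Q : Set} (P? : Dec P) (Q? : Dec Q) → (P → Q) → ⟦ P? ⟧ ℕ.≤ ⟦ Q? ⟧
⟦⟧-mono (yes p) Q? f = ℕ.≤-reflexive (sym (⟦⟧-yes Q? (f p)))
⟦⟧-mono (no _)  Q? f = z≤n

⟦⟧≡0∨1 : ∀ {P : Set} (P? : Dec P) → ⟦ P? ⟧ ≡ 0 ⊎ ⟦ P? ⟧ ≡ 1
⟦⟧≡0∨1 (yes _) = inj₂ refl
⟦⟧≡0∨1 (no _)  = inj₁ refl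

⟦⟧≡1⇒ : ∀ {P : Set} (P? : Dec P) → ⟦ P? ⟧ ≡ 1 → P
⟦⟧≡1⇒ (yes p) _ = p

sum-diagonal : ∀ {n} (i : Fin n) → ∑[ j < n ] ⟦ i Fin.≟ j ⟧ ≡ 1
sum-diagonal {suc n} zero    = cong (1 ℕ.+_) (trans (sum-const n 0) (ℕ.*-zeroʳ n))
sum-diagonal {suc n} (suc i) = sum-diagonal i

-- This is 0 ≤ (a - b)²: with the larger number written as the smaller plus `d`, the two sides
-- differ by `d * d`.
2ab≤a²+b² : ∀ a b → 2 * (a * b) ℕ.≤ a * a + b * b
2ab≤a²+b² a b with ℕ.≤-total a b
... | inj₁ a≤b = subst (λ b → 2 * (a * b) ℕ.≤ a * a + b * b) (ℕ.m+[n∸m]≡n a≤b)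
  (ℕ.m+n≤o⇒m≤o _ (ℕ.≤-reflexive (arith a (b ∸ a))))
  where
  arith : ∀ a d → 2 * (a * (a + d)) + d * d ≡ a * a + (a + d) * (a + d)
  arith = solve-∀
... | inj₂ b≤a = subst (λ a → 2 * (a * b) ℕ.≤ a * a + b * b) (ℕ.m+[n∸m]≡n b≤a)
  (ℕ.m+n≤o⇒m≤o _ (ℕ.≤-reflexive (arith b (a ∸ b))))
  where
  arith : ∀ b d → 2 * ((b + d) * b) + d * d ≡ (b + d) * (b + d) + b * b
  arith = solve-∀

-- The second moment of the window counts

window? : ∀ k L t → Dec (k ℕ.≤ t × t ℕ.< k + L)
window? k L t = (k ℕ.≤? t) ×-dec (t ℕ.<? k + L)

window : ℕ → ℕ → ℕ → ℕ
window k L t = ⟦ window? k L t ⟧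

-- The range [0, M) is cut at `k` and `k + L`: the indicator is 0 on the outer pieces and 1 on the
-- middle one.
sum-window : ∀ k L {M} (g : ℕ → ℕ) → k + L ℕ.≤ M →
  ∑[ t < M ] (window k L (toℕ t) * g (toℕ t)) ≡ ∑[ r < L ] g (k + toℕ r)
sum-window k L {M} g k+L≤M = begin
  ∑[ t < M ] h (toℕ t)
    ≡⟨ cong (λ m → ∑[ t < m ] h (toℕ t)) (sym (ℕ.m+[n∸m]≡n k+L≤M)) ⟩
  ∑[ t < k + L + e ] h (toℕ t)
    ≡⟨ sum-toℕ-+ (k + L) e h ⟩
  ∑[ t < k + L ] h (toℕ t) + ∑[ t < e ] h (k + L + toℕ t)
    ≡⟨ cong₂ _+_ (sum-toℕ-+ k L h) (vanish e _ after) ⟩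
  ∑[ t < k ] h (toℕ t) + ∑[ r < L ] h (k + toℕ r) + 0
    ≡⟨ ℕ.+-identityʳ _ ⟩
  ∑[ t < k ] h (toℕ t) + ∑[ r < L ] h (k + toℕ r)
    ≡⟨ cong₂ _+_ (vanish k _ before) (sum-cong-≗ inside) ⟩
  ∑[ r < L ] g (k + toℕ r) ∎
  where
  open ≡-Reasoning
  h = λ t → window k L t * g t
  e = M ∸ (k + L)
  vanish : ∀ n (f : Fin n → ℕ) → (∀ i → f i ≡ 0) → sum f ≡ 0
  vanish n f f≡0 = trans (sum-cong-≗ f≡0) (trans (sum-const n 0) (ℕ.*-zeroʳ n))
  before : ∀ (t : Fin k) → h (toℕ t) ≡ 0
  before t = cong (_* g (toℕ t)) (⟦⟧-no (window? k L (toℕ t)) (λ (k≤t , _) → ℕ.<⇒≱ (Fin.toℕ<n t) k≤t))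
  inside : ∀ (r : Fin L) → h (k + toℕ r) ≡ g (k + toℕ r)
  inside r = trans
    (cong (_* g (k + toℕ r)) (⟦⟧-yes (window? k L (k + toℕ r)) (ℕ.m≤m+n k _ , ℕ.+-monoʳ-< k (Fin.toℕ<n r))))
    (ℕ.*-identityˡ _)
  after : ∀ (t : Fin e) → h (k + L + toℕ t) ≡ 0
  after t = cong (_* g (k + L + toℕ t))
    (⟦⟧-no (window? k L (k + L + toℕ t)) (λ (_ , t<k+L) → ℕ.<⇒≱ t<k+L (ℕ.m≤m+n (k + L) _)))

sum-window-length : ∀ k L {M} → k + L ℕ.≤ M → ∑[ t < M ] window k L (toℕ t) ≡ L
sum-window-length k L {M} k+L≤M = trans
  (sum-cong-≗ {M} (λ t → sym (ℕ.*-identityʳ (window k L (toℕ t)))))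
  (trans (sum-window k L (λ _ → 1) k+L≤M) (trans (sum-const L 1) (ℕ.*-identityʳ L)))

-- Both sides count the positions common to the two windows; the range `M` is chosen large enough to
-- contain both.
window-overlap-sym : ∀ k l S →
  ∑[ r < S ] window l S (k + toℕ r) ≡ ∑[ r < S ] window k S (l + toℕ r)
window-overlap-sym k l S = trans
  (sym (sum-window k S {M} (window l S) (ℕ.m≤m+n (k + S) (l + S))))
  (trans (sum-cong-≗ {M} (λ t → ℕ.*-comm (window k S (toℕ t)) (window l S (toℕ t))))
         (sum-window l S {M} (window k S) (ℕ.m≤n+m (l + S) (k + S))))
  where M = (k + S) + (l + S)

-- The right side is (S - |k - l|)⁺ written as a number of `r < S`, so that a sum over all pairs can
-- later be exchanged for a sum over distances.
window-overlap-≤ : ∀ k l S →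
  ∑[ r < S ] window l S (k + toℕ r) ℕ.≤ ∑[ r < S ] ⟦ ℕ.∣ k - l ∣ ℕ.≤? toℕ r ⟧
window-overlap-≤ k l S with ℕ.≤-total k l
... | inj₁ k≤l = sum-mono-≤ {S} (λ r → ⟦⟧-mono (window? l S (k + toℕ r)) (ℕ.∣ k - l ∣ ℕ.≤? toℕ r)
  (λ (l≤k+r , _) → subst (ℕ._≤ toℕ r) (sym (ℕ.m≤n⇒∣m-n∣≡n∸m k≤l)) (ℕ.m≤n+o⇒m∸n≤o l k l≤k+r)))
-- Here the overlap occupies the small values of `r` instead of the large ones, so the roles of the
-- windows are swapped before comparing term by term.
... | inj₂ l≤k = ℕ.≤-trans (ℕ.≤-reflexive (window-overlap-sym k l S))
  (sum-mono-≤ {S} (λ r → ⟦⟧-mono (window? k S (l + toℕ r)) (ℕ.∣ k - l ∣ ℕ.≤? toℕ r)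
  (λ (k≤l+r , _) → subst (ℕ._≤ toℕ r) (sym (ℕ.m≤n⇒∣n-m∣≡n∸m l≤k)) (ℕ.m≤n+o⇒m∸n≤o k l k≤l+r))))

module WindowCounts {N : ℕ} (S : ℕ) (k : Fin N → ℕ) (k≤N : ∀ i → k i ℕ.≤ N) where

  f : ℕ → ℕ
  f t = ∑[ i < N ] window (k i) S t

  -- Every window lies in [0, N + S), since a point at 1 may have `k i = N`.
  M : ℕ
  M = N + S

  -- Exchanging the sums turns a weighted sum of `f` into a sum of the weight over each point's
  -- window. The weight `f` gives the second moment; the indicator of a range gives point counts.
  sum-f* : ∀ (g : ℕ → ℕ) →
    ∑[ t < M ] (f (toℕ t) * g (toℕ t)) ≡ ∑[ i < N ] ∑[ r < S ] g (k i + toℕ r)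
  sum-f* g = begin
    ∑[ t < M ] (f (toℕ t) * g (toℕ t))
      ≡⟨ sum-cong-≗ {M} (λ t → *-distribʳ-sum (g (toℕ t)) (λ i → window (k i) S (toℕ t))) ⟩
    ∑[ t < M ] ∑[ i < N ] (window (k i) S (toℕ t) * g (toℕ t))
      ≡⟨ ∑-comm (λ (t : Fin M) (i : Fin N) → window (k i) S (toℕ t) * g (toℕ t)) ⟩
    ∑[ i < N ] ∑[ t < M ] (window (k i) S (toℕ t) * g (toℕ t))
      ≡⟨ sum-cong-≗ (λ i → sum-window (k i) S g (ℕ.+-monoˡ-≤ S (k≤N i))) ⟩
    ∑[ i < N ] ∑[ r < S ] g (k i + toℕ r) ∎
    where open ≡-Reasoning

  sum-f : ∑[ t < M ] f (toℕ t) ≡ N * S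
  sum-f = trans (∑-comm (λ (t : Fin M) (i : Fin N) → window (k i) S (toℕ t)))
    (trans (sum-cong-≗ (λ i → sum-window-length (k i) S (ℕ.+-monoˡ-≤ S (k≤N i)))) (sum-const N S))

  -- Cells at index distance at most `r` hold points at distance at most (r + 1)/N, so level `r`
  -- corresponds to s = `1 + r`.
  close : ℕ → Fin N → Fin N → ℕ
  close r i j = ⟦ ¬? (i Fin.≟ j) ×-dec (ℕ.∣ k i - k j ∣ ℕ.≤? r) ⟧

  module _ (pairs : ∀ (r : Fin S) → ∑[ i < N ] ∑[ j < N ] close (toℕ r) i j ℕ.≤ N * (2 * (1 + toℕ r) + 1)) where

    overlap-≤ : ∀ i j → ∑[ r < S ] window (k j) S (k i + toℕ r) ℕ.≤
      S * ⟦ i Fin.≟ j ⟧ + ∑[ r < S ] close (toℕ r) i j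
    overlap-≤ i j with i Fin.≟ j
    ... | yes _ = ℕ.≤-trans (sum-mono-≤ {S} (λ r → ⟦⟧≤1 (window? (k j) S (k i + toℕ r))))
      (ℕ.≤-trans (ℕ.≤-reflexive (sum-const S 1)) (ℕ.m≤m+n (S * 1) _))
    ... | no i≢j = ℕ.≤-trans (window-overlap-≤ (k i) (k j) S)
      (ℕ.≤-trans (ℕ.≤-reflexive (sum-cong-≗ {S} λ r → same (ℕ.∣ k i - k j ∣ ℕ.≤? toℕ r))) (ℕ.m≤n+m _ (S * 0)))
      where
      same : ∀ {P : Set} (P? : Dec P) → ⟦ P? ⟧ ≡ ⟦ yes i≢j ×-dec P? ⟧
      same (yes _) = refl
      same (no _)  = refl

    -- The diagonal contributes N S, and the close pairs, summed over the levels `r < S`, at most N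
    -- (S² + 2S).
    sum-f² : ∑[ t < M ] (f (toℕ t) * f (toℕ t)) ℕ.≤ N * (S * S + 3 * S)
    sum-f² = begin
      ∑[ t < M ] (f (toℕ t) * f (toℕ t))
        ≡⟨ sum-f* f ⟩
      ∑[ i < N ] ∑[ r < S ] ∑[ j < N ] window (k j) S (k i + toℕ r)
        ≡⟨ sum-cong-≗ (λ i → ∑-comm (λ (r : Fin S) (j : Fin N) → window (k j) S (k i + toℕ r))) ⟩
      ∑[ i < N ] ∑[ j < N ] ∑[ r < S ] window (k j) S (k i + toℕ r)
        ≤⟨ sum-mono-≤ (λ i → sum-mono-≤ (overlap-≤ i)) ⟩
      ∑[ i < N ] ∑[ j < N ] (S * ⟦ i Fin.≟ j ⟧ + ∑[ r < S ] close (toℕ r) i j)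
        ≡⟨ sum-cong-≗ (λ i → trans
             (∑-distrib-+ (λ j → S * ⟦ i Fin.≟ j ⟧) _)
             (cong₂ _+_ (trans (sym (*-distribˡ-sum S (λ j → ⟦ i Fin.≟ j ⟧))) (trans (cong (S *_) (sum-diagonal i)) (ℕ.*-identityʳ S)))
                        (∑-comm (λ (j : Fin N) (r : Fin S) → close (toℕ r) i j)))) ⟩
      ∑[ i < N ] (S + ∑[ r < S ] ∑[ j < N ] close (toℕ r) i j)
        ≡⟨ trans (∑-distrib-+ (λ (_ : Fin N) → S) _)
             (cong₂ _+_ (sum-const N S) (∑-comm (λ (i : Fin N) (r : Fin S) → ∑[ j < N ] close (toℕ r) i j))) ⟩
      N * S + ∑[ r < S ] ∑[ i < N ] ∑[ j < N ] close (toℕ r) i j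
        ≤⟨ ℕ.+-monoʳ-≤ (N * S) (sum-mono-≤ pairs) ⟩
      N * S + ∑[ r < S ] (N * (2 * (1 + toℕ r) + 1))
        ≡⟨ cong (N * S ℕ.+_) (trans (sym (*-distribˡ-sum N (λ (r : Fin S) → 2 * (1 + toℕ r) + 1))) (cong (N *_) (sum-odd S 1))) ⟩
      N * S + N * (S * S + 2 * (1 * S))
        ≡⟨ arith N S ⟩
      N * (S * S + 3 * S) ∎
      where
      open ℕ.≤-Reasoning
      arith : ∀ N S → N * S + N * (S * S + 2 * (1 * S)) ≡ N * (S * S + 3 * S)
      arith = solve-∀

    -- Both bounds sum the inequalities 0 ≤ (f − S ∓ l)² over the support of χ and
    -- 0 ≤ (f − S)² off it, written without subtraction.
    module _ (l : ℕ) (χ : ℕ → ℕ) (χ≡0∨1 : ∀ t → χ t ≡ 0 ⊎ χ t ≡ 1) where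

      private
        ∣χ∣ fχ : ℕ
        ∣χ∣ = ∑[ t < M ] χ (toℕ t)
        fχ = ∑[ t < M ] (f (toℕ t) * χ (toℕ t))

      sum-f-upper : 2 * l * fχ ℕ.≤ (2 * l * S + l * l) * ∣χ∣ + (3 * (S * N) + S * S * S)
      sum-f-upper = ℕ.+-cancelˡ-≤ (2 * S * (N * S)) _ _ (begin
        2 * S * (N * S) + 2 * l * fχ
          ≡⟨ cong₂ _+_ (cong (2 * S *_) (sym sum-f)) refl ⟩
        2 * S * ∑[ t < M ] f (toℕ t) + 2 * l * fχ
          ≡⟨ cong₂ _+_ (*-distribˡ-sum (2 * S) (λ (t : Fin M) → f (toℕ t)))
                       (*-distribˡ-sum (2 * l) (λ (t : Fin M) → f (toℕ t) * χ (toℕ t))) ⟩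
        ∑[ t < M ] (2 * S * f (toℕ t)) + ∑[ t < M ] (2 * l * (f (toℕ t) * χ (toℕ t)))
          ≡⟨ sym (∑-distrib-+ (λ (t : Fin M) → 2 * S * f (toℕ t)) _) ⟩
        ∑[ t < M ] (2 * S * f (toℕ t) + 2 * l * (f (toℕ t) * χ (toℕ t)))
          ≤⟨ sum-mono-≤ {M} (λ t → pointwise (f (toℕ t)) (χ (toℕ t)) (χ≡0∨1 (toℕ t))) ⟩
        ∑[ t < M ] (f (toℕ t) * f (toℕ t) + (S * S + (2 * l * S + l * l) * χ (toℕ t)))
          ≡⟨ trans (∑-distrib-+ (λ (t : Fin M) → f (toℕ t) * f (toℕ t)) _)
               (cong (∑[ t < M ] (f (toℕ t) * f (toℕ t)) ℕ.+_) (trans (∑-distrib-+ (λ (_ : Fin M) → S * S) _)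
                 (cong₂ _+_ (sum-const M (S * S)) (sym (*-distribˡ-sum (2 * l * S + l * l) (λ (t : Fin M) → χ (toℕ t))))))) ⟩
        ∑[ t < M ] (f (toℕ t) * f (toℕ t)) + ((N + S) * (S * S) + (2 * l * S + l * l) * ∣χ∣)
          ≤⟨ ℕ.+-monoˡ-≤ _ sum-f² ⟩
        -- The terms N S² cancel against the cross term 2 S · N S. What remains is 3 S N from the
        -- excess in the second moment and S³ from the `S` extra positions.
        N * (S * S + 3 * S) + ((N + S) * (S * S) + (2 * l * S + l * l) * ∣χ∣)
          ≡⟨ arith N S ((2 * l * S + l * l) * ∣χ∣) ⟩
        2 * S * (N * S) + ((2 * l * S + l * l) * ∣χ∣ + (3 * (S * N) + S * S * S)) ∎)
        where
        open ℕ.≤-Reasoning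
        arith : ∀ N S x → N * (S * S + 3 * S) + ((N + S) * (S * S) + x) ≡
          2 * S * (N * S) + (x + (3 * (S * N) + S * S * S))
        arith = solve-∀
        off₁ : ∀ S l y → 2 * (y * S) ≡ 2 * S * y + 2 * l * (y * 0)
        off₁ = solve-∀
        off₂ : ∀ S l y → y * y + S * S ≡ y * y + (S * S + (2 * l * S + l * l) * 0)
        off₂ = solve-∀
        on₁ : ∀ S l y → 2 * (y * (S + l)) ≡ 2 * S * y + 2 * l * (y * 1)
        on₁ = solve-∀
        on₂ : ∀ S l y → y * y + (S + l) * (S + l) ≡ y * y + (S * S + (2 * l * S + l * l) * 1)
        on₂ = solve-∀
        pointwise : ∀ y c → c ≡ 0 ⊎ c ≡ 1 →
          2 * S * y + 2 * l * (y * c) ℕ.≤ y * y + (S * S + (2 * l * S + l * l) * c)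
        pointwise y .0 (inj₁ refl) = subst₂ ℕ._≤_ (off₁ S l y) (off₂ S l y) (2ab≤a²+b² y S)
        pointwise y .1 (inj₂ refl) = subst₂ ℕ._≤_ (on₁ S l y) (on₂ S l y) (2ab≤a²+b² y (S + l))

      sum-f-lower : 2 * l * S * ∣χ∣ ℕ.≤ 2 * l * fχ + (l * l * ∣χ∣ + (3 * (S * N) + S * S * S))
      sum-f-lower = ℕ.+-cancelˡ-≤ (2 * S * (N * S)) _ _ (begin
        2 * S * (N * S) + 2 * l * S * ∣χ∣
          ≡⟨ cong₂ _+_ (cong (2 * S *_) (sym sum-f)) refl ⟩
        2 * S * ∑[ t < M ] f (toℕ t) + 2 * l * S * ∣χ∣
          ≡⟨ cong₂ _+_ (*-distribˡ-sum (2 * S) (λ (t : Fin M) → f (toℕ t)))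
                       (*-distribˡ-sum (2 * l * S) (λ (t : Fin M) → χ (toℕ t))) ⟩
        ∑[ t < M ] (2 * S * f (toℕ t)) + ∑[ t < M ] (2 * l * S * χ (toℕ t))
          ≡⟨ sym (∑-distrib-+ (λ (t : Fin M) → 2 * S * f (toℕ t)) _) ⟩
        ∑[ t < M ] (2 * S * f (toℕ t) + 2 * l * S * χ (toℕ t))
          ≤⟨ sum-mono-≤ {M} (λ t → pointwise (f (toℕ t)) (χ (toℕ t)) (χ≡0∨1 (toℕ t))) ⟩
        ∑[ t < M ] (f (toℕ t) * f (toℕ t) + (S * S + (l * l * χ (toℕ t) + 2 * l * (f (toℕ t) * χ (toℕ t)))))
          ≡⟨ trans (∑-distrib-+ (λ (t : Fin M) → f (toℕ t) * f (toℕ t)) _)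
               (cong (∑[ t < M ] (f (toℕ t) * f (toℕ t)) ℕ.+_) (trans (∑-distrib-+ (λ (_ : Fin M) → S * S) _)
                 (cong₂ _+_ (sum-const M (S * S)) (trans (∑-distrib-+ (λ (t : Fin M) → l * l * χ (toℕ t)) _)
                   (cong₂ _+_ (sym (*-distribˡ-sum (l * l) (λ (t : Fin M) → χ (toℕ t))))
                              (sym (*-distribˡ-sum (2 * l) (λ (t : Fin M) → f (toℕ t) * χ (toℕ t))))))))) ⟩
        ∑[ t < M ] (f (toℕ t) * f (toℕ t)) + ((N + S) * (S * S) + (l * l * ∣χ∣ + 2 * l * fχ))
          ≤⟨ ℕ.+-monoˡ-≤ _ sum-f² ⟩
        N * (S * S + 3 * S) + ((N + S) * (S * S) + (l * l * ∣χ∣ + 2 * l * fχ))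
          ≡⟨ arith N S (l * l * ∣χ∣) (2 * l * fχ) ⟩
        2 * S * (N * S) + (2 * l * fχ + (l * l * ∣χ∣ + (3 * (S * N) + S * S * S))) ∎)
        where
        open ℕ.≤-Reasoning
        arith : ∀ N S x y → N * (S * S + 3 * S) + ((N + S) * (S * S) + (x + y)) ≡
          2 * S * (N * S) + (y + (x + (3 * (S * N) + S * S * S)))
        arith = solve-∀
        off₁ : ∀ S l y → 2 * (y * S) ≡ 2 * S * y + 2 * l * S * 0
        off₁ = solve-∀
        off₂ : ∀ S l y → y * y + S * S ≡ y * y + (S * S + (l * l * 0 + 2 * l * (y * 0)))
        off₂ = solve-∀
        on₁ : ∀ S l y → 2 * ((y + l) * S) ≡ 2 * S * y + 2 * l * S * 1
        on₁ = solve-∀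
        on₂ : ∀ S l y → (y + l) * (y + l) + S * S ≡ y * y + (S * S + (l * l * 1 + 2 * l * (y * 1)))
        on₂ = solve-∀
        pointwise : ∀ y c → c ≡ 0 ⊎ c ≡ 1 →
          2 * S * y + 2 * l * S * c ℕ.≤ y * y + (S * S + (l * l * c + 2 * l * (y * c)))
        pointwise y .0 (inj₁ refl) = subst₂ ℕ._≤_ (off₁ S l y) (off₂ S l y) (2ab≤a²+b² y S)
        pointwise y .1 (inj₂ refl) = subst₂ ℕ._≤_ (on₁ S l y) (on₂ S l y) (2ab≤a²+b² (y + l) S)

-- Counting the points in a range of cells

module IntervalCounts {N : ℕ} (l : ℕ) .{{_ : NonZero l}} (l⁴≤N : l * l * (l * l) ℕ.≤ N)
  (k : Fin N → ℕ) (k≤N : ∀ i → k i ℕ.≤ N) where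

  private
    -- For this choice the term `l * l` in the two variance bounds equals `S`, so a factor `S` can
    -- be cancelled from them.
    S : ℕ
    S = l * l

    instance
      S≢0 : NonZero S
      S≢0 = ℕ.m*n≢0 l l

  open WindowCounts S k k≤N public

  module _
    (pairs : ∀ (r : Fin (l * l)) → ∑[ i < N ] ∑[ j < N ] close (toℕ r) i j ℕ.≤ N * (2 * (1 + toℕ r) + 1))
    (a b : ℕ) (a≤b : a ℕ.≤ b) (b≤N : b ℕ.≤ N)
    (v : Fin N → ℕ) (v≡0∨1 : ∀ i → v i ≡ 0 ⊎ v i ≡ 1) where

    private
      l≤S : l ℕ.≤ S
      l≤S = ℕ.m≤n*m l l

      S≤N : S ℕ.≤ N
      S≤N = ℕ.≤-trans (ℕ.m≤n*m S S) l⁴≤N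

      -- Collects the losses: `l * S` from windows overhanging the range, `l` from rounding the
      -- endpoints, `3 * N` from the variance. The first two are at most `N` each because l⁴ ≤ N.
      slack : l * S + (l + 3 * N) ℕ.≤ 5 * N
      slack = ℕ.≤-trans
        (ℕ.+-mono-≤ (ℕ.≤-trans (ℕ.*-monoˡ-≤ S l≤S) l⁴≤N) (ℕ.+-monoˡ-≤ (3 * N) (ℕ.≤-trans l≤S S≤N)))
        (ℕ.≤-reflexive (arith N))
        where
        arith : ∀ N → N + (N + 3 * N) ≡ 5 * N
        arith = solve-∀

      -- Uses S ≤ N for the first term and S² = l⁴ ≤ N for the last. Division by 2S will leave the
      -- error `3 * N`.
      error : ∀ {d} → d ℕ.≤ N + S → S * d + (3 * (S * N) + S * S * S) ℕ.≤ S * (6 * N)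
      error {d} d≤N+S = begin
        S * d + (3 * (S * N) + S * S * S)        ≤⟨ ℕ.+-mono-≤ (ℕ.*-monoʳ-≤ S (ℕ.≤-trans d≤N+S (ℕ.+-monoʳ-≤ N S≤N)))
                                                      (ℕ.+-monoʳ-≤ (3 * (S * N)) (ℕ.*-monoˡ-≤ S l⁴≤N)) ⟩
        S * (N + N) + (3 * (S * N) + N * S)      ≡⟨ arith S N ⟩
        S * (6 * N)                              ∎
        where
        open ℕ.≤-Reasoning
        arith : ∀ S N → S * (N + N) + (3 * (S * N) + N * S) ≡ S * (6 * N)
        arith = solve-∀

      cancel : ∀ x y → S * (2 * x) ℕ.≤ S * (2 * y) + S * (6 * N) → x ℕ.≤ y + 3 * N
      cancel x y h = ℕ.*-cancelˡ-≤ 2 (ℕ.*-cancelˡ-≤ S (ℕ.≤-trans h (ℕ.≤-reflexive (arith S N y))))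
        where
        arith : ∀ S N y → S * (2 * y) + S * (6 * N) ≡ S * (2 * (y + 3 * N))
        arith = solve-∀

      χ≡0∨1 : ∀ c L t → window c L t ≡ 0 ⊎ window c L t ≡ 1
      χ≡0∨1 c L t = ⟦⟧≡0∨1 (window? c L t)

    -- The window of every counted point lies inside [a, b + S), so `S` times the count is at most
    -- the sum of `f` over that range, which `sum-f-upper` bounds.
    count-upper : (∀ i → v i ≡ 1 → a ℕ.≤ k i × k i ℕ.≤ b) → l * (sum v + a + 1) ℕ.≤ l * b + 5 * N
    count-upper inside = begin
      l * (sum v + a + 1)            ≡⟨ arith₁ l (sum v) a ⟩
      l * sum v + l * a + l          ≤⟨ ℕ.+-monoˡ-≤ l (ℕ.+-monoˡ-≤ (l * a) lV≤) ⟩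
      l * d + 3 * N + l * a + l      ≡⟨ arith₂ l d N a ⟩
      l * (a + d) + l + 3 * N        ≡⟨ cong (λ u → l * u + l + 3 * N) a+d ⟩
      l * (b + S) + l + 3 * N        ≡⟨ arith₃ l b S N ⟩
      l * b + (l * S + (l + 3 * N))  ≤⟨ ℕ.+-monoʳ-≤ (l * b) slack ⟩
      l * b + 5 * N                  ∎
      where
      open ℕ.≤-Reasoning
      arith₁ : ∀ l V a → l * (V + a + 1) ≡ l * V + l * a + l
      arith₁ = solve-∀
      arith₂ : ∀ l d N a → l * d + 3 * N + l * a + l ≡ l * (a + d) + l + 3 * N
      arith₂ = solve-∀
      arith₃ : ∀ l b S N → l * (b + S) + l + 3 * N ≡ l * b + (l * S + (l + 3 * N))
      arith₃ = solve-∀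
      arith₄ : ∀ l S V → S * (2 * (l * V)) ≡ 2 * l * (V * S)
      arith₄ = solve-∀
      arith₅ : ∀ l S d e → (2 * l * S + S) * d + e ≡ S * (2 * (l * d)) + (S * d + e)
      arith₅ = solve-∀
      d = (b + S) ∸ a
      a+d : a + d ≡ b + S
      a+d = ℕ.m+[n∸m]≡n (ℕ.≤-trans a≤b (ℕ.m≤m+n b S))
      a+d≤M : a + d ℕ.≤ N + S
      a+d≤M = ℕ.≤-trans (ℕ.≤-reflexive a+d) (ℕ.+-monoˡ-≤ S b≤N)
      χ = window a d
      point : ∀ i → v i * S ℕ.≤ ∑[ r < S ] χ (k i + toℕ r)
      point i with v≡0∨1 i
      ... | inj₁ v≡0 rewrite v≡0 = z≤n
      ... | inj₂ v≡1 = ℕ.≤-reflexive (trans (cong (_* S) v≡1) (trans (ℕ.*-comm 1 S)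
        (sym (trans (sum-cong-≗ {S} (λ r → ⟦⟧-yes (window? a d (k i + toℕ r))
          (ℕ.≤-trans a≤k (ℕ.m≤m+n (k i) _) ,
           subst (k i + toℕ r ℕ.<_) (sym a+d) (ℕ.+-mono-≤-< k≤b (Fin.toℕ<n r)))))
          (sum-const S 1)))))
        where
        a≤k = proj₁ (inside i v≡1)
        k≤b = proj₂ (inside i v≡1)
      VS≤ : sum v * S ℕ.≤ ∑[ t < M ] (f (toℕ t) * χ (toℕ t))
      VS≤ = begin
        sum v * S                               ≡⟨ *-distribʳ-sum S v ⟩
        ∑[ i < N ] (v i * S)                    ≤⟨ sum-mono-≤ point ⟩
        ∑[ i < N ] ∑[ r < S ] χ (k i + toℕ r)   ≡⟨ sum-f* χ ⟨
        ∑[ t < M ] (f (toℕ t) * χ (toℕ t))      ∎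
      lV≤ : l * sum v ℕ.≤ l * d + 3 * N
      lV≤ = cancel (l * sum v) (l * d) (begin
        S * (2 * (l * sum v))
          ≡⟨ arith₄ l S (sum v) ⟩
        2 * l * (sum v * S)
          ≤⟨ ℕ.*-monoʳ-≤ (2 * l) VS≤ ⟩
        2 * l * ∑[ t < M ] (f (toℕ t) * χ (toℕ t))
          ≤⟨ sum-f-upper pairs l χ (χ≡0∨1 a d) ⟩
        (2 * l * S + S) * ∑[ t < M ] χ (toℕ t) + (3 * (S * N) + S * S * S)
          ≡⟨ cong (λ u → (2 * l * S + S) * u + (3 * (S * N) + S * S * S)) (sum-window-length a d a+d≤M) ⟩
        (2 * l * S + S) * d + (3 * (S * N) + S * S * S)
          ≡⟨ arith₅ l S d (3 * (S * N) + S * S * S) ⟩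
        S * (2 * (l * d)) + (S * d + (3 * (S * N) + S * S * S))
          ≤⟨ ℕ.+-monoʳ-≤ (S * (2 * (l * d))) (error (ℕ.≤-trans (ℕ.m≤n+m d a) a+d≤M)) ⟩
        S * (2 * (l * d)) + S * (6 * N) ∎)

    -- A window meeting [a + S, b) starts strictly between `a` and `b`, so its point is counted.
    -- Hence the sum of `f` over that range, bounded below by `sum-f-lower`, is at most `S` times
    -- the count.
    count-lower : (∀ i → a ℕ.< k i → k i ℕ.< b → v i ≡ 1) → l * (b + 1) ℕ.≤ l * (sum v + a) + 5 * N
    count-lower inside = begin
      l * (b + 1)                               ≤⟨ ℕ.*-monoʳ-≤ l (ℕ.+-monoˡ-≤ 1 (ℕ.m≤n+m∸n b c)) ⟩
      l * (c + d + 1)                           ≡⟨ arith₁ l a S d ⟩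
      l * d + (l * a + l * S + l)               ≤⟨ ℕ.+-monoˡ-≤ _ ld≤ ⟩
      l * sum v + 3 * N + (l * a + l * S + l)   ≡⟨ arith₂ l (sum v) N a S ⟩
      l * (sum v + a) + (l * S + (l + 3 * N))   ≤⟨ ℕ.+-monoʳ-≤ (l * (sum v + a)) slack ⟩
      l * (sum v + a) + 5 * N                   ∎
      where
      open ℕ.≤-Reasoning
      arith₁ : ∀ l a S d → l * (a + S + d + 1) ≡ l * d + (l * a + l * S + l)
      arith₁ = solve-∀
      arith₂ : ∀ l V N a S → l * V + 3 * N + (l * a + l * S + l) ≡ l * (V + a) + (l * S + (l + 3 * N))
      arith₂ = solve-∀
      arith₃ : ∀ l S d → S * (2 * (l * d)) ≡ 2 * l * S * d
      arith₃ = solve-∀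
      arith₄ : ∀ l S V → 2 * l * (V * S) ≡ S * (2 * (l * V))
      arith₄ = solve-∀
      c = a + S
      -- Truncated subtraction: for `b ≤ c` the range is empty, and `b ≤ c + d` still holds.
      d = b ∸ c
      c+d≤M : c + d ℕ.≤ N + S
      c+d≤M with ℕ.≤-total c b
      ... | inj₁ c≤b = ℕ.≤-trans (ℕ.≤-reflexive (ℕ.m+[n∸m]≡n c≤b)) (ℕ.≤-trans b≤N (ℕ.m≤m+n N S))
      ... | inj₂ b≤c = ℕ.≤-trans (ℕ.≤-reflexive (trans (cong (c ℕ.+_) (ℕ.m≤n⇒m∸n≡0 b≤c)) (ℕ.+-identityʳ c)))
                                 (ℕ.+-monoˡ-≤ S (ℕ.≤-trans a≤b b≤N))
      χ = window c d
      χ-support : ∀ {t} → c ℕ.≤ t → t ℕ.< c + d → t ℕ.< b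
      χ-support {t} c≤t t<c+d with ℕ.≤-total c b
      ... | inj₁ c≤b = subst (t ℕ.<_) (ℕ.m+[n∸m]≡n c≤b) t<c+d
      ... | inj₂ b≤c = ⊥-elim (ℕ.<⇒≱ (subst (t ℕ.<_)
        (trans (cong (c ℕ.+_) (ℕ.m≤n⇒m∸n≡0 b≤c)) (ℕ.+-identityʳ c)) t<c+d) c≤t)
      χ≤v : ∀ i (r : Fin S) → χ (k i + toℕ r) ℕ.≤ v i
      χ≤v i r with χ≡0∨1 c d (k i + toℕ r)
      ... | inj₁ χ≡0 = ℕ.≤-trans (ℕ.≤-reflexive χ≡0) z≤n
      ... | inj₂ χ≡1 = ℕ.≤-reflexive (trans χ≡1 (sym (inside i a<k k<b)))
        where
        t∈ = ⟦⟧≡1⇒ (window? c d (k i + toℕ r)) χ≡1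
        a<k : a ℕ.< k i
        a<k = ℕ.+-cancelʳ-< S a (k i) (ℕ.≤-<-trans (proj₁ t∈) (ℕ.+-monoʳ-< (k i) (Fin.toℕ<n r)))
        k<b : k i ℕ.< b
        k<b = ℕ.≤-<-trans (ℕ.m≤m+n (k i) (toℕ r)) (χ-support (proj₁ t∈) (proj₂ t∈))
      ≤VS : ∑[ t < M ] (f (toℕ t) * χ (toℕ t)) ℕ.≤ sum v * S
      ≤VS = begin
        ∑[ t < M ] (f (toℕ t) * χ (toℕ t))      ≡⟨ sum-f* χ ⟩
        ∑[ i < N ] ∑[ r < S ] χ (k i + toℕ r)   ≤⟨ sum-mono-≤ (λ i → sum-mono-≤ {S} (χ≤v i)) ⟩
        ∑[ i < N ] ∑[ r < S ] v i               ≡⟨ sum-cong-≗ (λ i → trans (sum-const S (v i)) (ℕ.*-comm S (v i))) ⟩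
        ∑[ i < N ] (v i * S)                    ≡⟨ *-distribʳ-sum S v ⟨
        sum v * S                               ∎
      ld≤ : l * d ℕ.≤ l * sum v + 3 * N
      ld≤ = cancel (l * d) (l * sum v) (begin
        S * (2 * (l * d))
          ≡⟨ arith₃ l S d ⟩
        2 * l * S * d
          ≡⟨ cong (2 * l * S *_) (sum-window-length c d c+d≤M) ⟨
        2 * l * S * ∑[ t < M ] χ (toℕ t)
          ≤⟨ sum-f-lower pairs l χ (χ≡0∨1 c d) ⟩
        2 * l * ∑[ t < M ] (f (toℕ t) * χ (toℕ t)) + (S * ∑[ t < M ] χ (toℕ t) + (3 * (S * N) + S * S * S))
          ≤⟨ ℕ.+-mono-≤ (ℕ.*-monoʳ-≤ (2 * l) ≤VS)
               (ℕ.≤-trans (ℕ.≤-reflexive (cong (λ u → S * u + (3 * (S * N) + S * S * S)) (sum-window-length c d c+d≤M)))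
                          (error (ℕ.≤-trans (ℕ.m≤n+m d c) c+d≤M))) ⟩
        2 * l * (sum v * S) + S * (6 * N)
          ≡⟨ cong (_+ S * (6 * N)) (arith₄ l S (sum v)) ⟩
        S * (2 * (l * sum v)) + S * (6 * N) ∎)

-- Counts as sums

module _ (em : ExcludedMiddle 0ℓ) where

  count-tabulate : ∀ {A : Set} (P : A → Set) {n} (g : Fin n → A) →
    count em P (tabulate g) ≡ ∑[ i < n ] ⟦ em {P (g i)} ⟧
  count-tabulate P {zero}  g = refl
  count-tabulate P {suc n} g with ih ← count-tabulate P (g ∘ suc) | em {P (g zero)}
  ... | yes _ = cong suc ih
  ... | no  _ = ih

  count-cartesianProduct : ∀ {A B : Set} (P : A × B → Set) {m n} (g : Fin m → A) (h : Fin n → B) →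
    count em P (cartesianProduct (tabulate g) (tabulate h)) ≡ ∑[ i < m ] ∑[ j < n ] ⟦ em {P (g i , h j)} ⟧
  count-cartesianProduct P {zero}  g h = refl
  count-cartesianProduct P {suc m} g h = trans
    (cong length (filter-++ P? (map (g zero ,_) (tabulate h)) (cartesianProduct (tabulate (g ∘ suc)) (tabulate h))))
    (trans (length-++ (filter P? (map (g zero ,_) (tabulate h))))
      (cong₂ _+_
        (trans (cong (count em P) (map-tabulate h (g zero ,_))) (count-tabulate P (λ j → g zero , h j)))
        (count-cartesianProduct P (g ∘ suc) h)))
    where P? = λ a → em {P a}

-- Rational inequalities

-- `_/_` reduces to lowest terms; unnormalised fractions make cross-multiplication available.
toℚᵘ-/ : ∀ a n → toℚᵘ (+ a / suc n) ℚᵘ.≃ ℚᵘ.mkℚᵘ (+ a) n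
toℚᵘ-/ a n = ℚ.toℚᵘ-fromℚᵘ (ℚᵘ.mkℚᵘ (+ a) n)

/-≤-/ : ∀ a n b m .{{_ : NonZero n}} .{{_ : NonZero m}} → a * m ℕ.≤ b * n → + a / n ℚ.≤ + b / m
/-≤-/ a (suc n) b (suc m) h = ℚ.toℚᵘ-cancel-≤ (begin
  toℚᵘ (+ a / suc n)   ≃⟨ toℚᵘ-/ a n ⟩
  ℚᵘ.mkℚᵘ (+ a) n      ≤⟨ ℚᵘ.*≤* (subst₂ ℤ._≤_ (ℤ.pos-* a (suc m)) (ℤ.pos-* b (suc n)) (ℤ.+≤+ h)) ⟩
  ℚᵘ.mkℚᵘ (+ b) m      ≃⟨ toℚᵘ-/ b m ⟨
  toℚᵘ (+ b / suc m)   ∎)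
  where open ℚᵘ.≤-Reasoning

/-≤-/⁻¹ : ∀ a n b m .{{_ : NonZero n}} .{{_ : NonZero m}} → + a / n ℚ.≤ + b / m → a * m ℕ.≤ b * n
/-≤-/⁻¹ a (suc n) b (suc m) h = ℤ.drop‿+≤+
  (subst₂ ℤ._≤_ (sym (ℤ.pos-* a (suc m))) (sym (ℤ.pos-* b (suc n))) (ℚᵘ.drop-*≤* (begin
    ℚᵘ.mkℚᵘ (+ a) n      ≃⟨ toℚᵘ-/ a n ⟨
    toℚᵘ (+ a / suc n)   ≤⟨ ℚ.toℚᵘ-mono-≤ h ⟩
    toℚᵘ (+ b / suc m)   ≃⟨ toℚᵘ-/ b m ⟩
    ℚᵘ.mkℚᵘ (+ b) m      ∎)))
  where open ℚᵘ.≤-Reasoning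

/-≡-/ : ∀ a n b m .{{_ : NonZero n}} .{{_ : NonZero m}} → a * m ≡ b * n → + a / n ≡ + b / m
/-≡-/ a n b m h = ℚ.≤-antisym (/-≤-/ a n b m (ℕ.≤-reflexive h)) (/-≤-/ b m a n (ℕ.≤-reflexive (sym h)))

module _ (n : ℕ) .{{_ : NonZero n}} where

  /-mono-≤ : ∀ {a b} → a ℕ.≤ b → + a / n ℚ.≤ + b / n
  /-mono-≤ {a} {b} a≤b = /-≤-/ a n b n (ℕ.*-monoˡ-≤ n a≤b)

  /-cancel-< : ∀ {a b} → + a / n ℚ.< + b / n → a ℕ.< b
  /-cancel-< h = ℕ.≰⇒> (λ b≤a → ℚ.<-irrefl refl (ℚ.<-≤-trans h (/-mono-≤ b≤a)))

  /-mono-< : ∀ {a b} → a ℕ.< b → + a / n ℚ.< + b / n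
  /-mono-< {a} {b} a<b = ℚ.≰⇒> (λ h → ℕ.<⇒≱ a<b (ℕ.*-cancelʳ-≤ b a n (/-≤-/⁻¹ b n a n h)))

/-homo-+ : ∀ a b n .{{_ : NonZero n}} → + (a + b) / n ≡ + a / n ℚ.+ + b / n
/-homo-+ a b (suc n) = ℚ.toℚᵘ-injective (begin
  toℚᵘ (+ (a + b) / suc n)
    ≈⟨ toℚᵘ-/ (a + b) n ⟩
  ℚᵘ.mkℚᵘ (+ (a + b)) n
    ≈⟨ ℚᵘ.*≡* (trans (sym (ℤ.pos-* (a + b) (suc n * suc n))) (trans (cong +_ (arith a b (suc n)))
         (trans (ℤ.pos-* (a * suc n + b * suc n) (suc n))
           (cong (ℤ._* + suc n) (trans (ℤ.pos-+ (a * suc n) (b * suc n)) (cong₂ ℤ._+_ (ℤ.pos-* a (suc n)) (ℤ.pos-* b (suc n)))))))) ⟩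
  ℚᵘ.mkℚᵘ (+ a) n ℚᵘ.+ ℚᵘ.mkℚᵘ (+ b) n
    ≈⟨ ℚᵘ.+-cong (toℚᵘ-/ a n) (toℚᵘ-/ b n) ⟨
  toℚᵘ (+ a / suc n) ℚᵘ.+ toℚᵘ (+ b / suc n)
    ≈⟨ ℚ.toℚᵘ-homo-+ (+ a / suc n) (+ b / suc n) ⟨
  toℚᵘ (+ a / suc n ℚ.+ + b / suc n) ∎)
  where
  open import Relation.Binary.Reasoning.Setoid ℚᵘ.≃-setoid
  arith : ∀ a b n → (a + b) * (n * n) ≡ (a * n + b * n) * n
  arith = solve-∀

-- Division by `l * n` turns the integer estimates `count-upper` and `count-lower` into estimates of
-- proportions, with error `c / l`.
/-≤-+-/ : ∀ x y c l n .{{_ : NonZero l}} .{{_ : NonZero n}} →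
  l * x ℕ.≤ l * y + c * n → + x / n ℚ.≤ + y / n ℚ.+ + c / l
/-≤-+-/ x y c l n h = begin
  + x / n                                  ≡⟨ /-≡-/ x n (l * x) (l * n) (arith l x n) ⟩
  + (l * x) / (l * n)                      ≤⟨ /-mono-≤ (l * n) h ⟩
  + (l * y + c * n) / (l * n)              ≡⟨ /-homo-+ (l * y) (c * n) (l * n) ⟩
  + (l * y) / (l * n) ℚ.+ + (c * n) / (l * n)
    ≡⟨ cong₂ ℚ._+_ (/-≡-/ (l * y) (l * n) y n (sym (arith l y n))) (/-≡-/ (c * n) (l * n) c l (arith′ c l n)) ⟩
  + y / n ℚ.+ + c / l                      ∎
  where
  open ℚ.≤-Reasoning
  instance
    ln≢0 : NonZero (l * n)
    ln≢0 = ℕ.m*n≢0 l n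
  arith : ∀ l x n → x * (l * n) ≡ l * x * n
  arith = solve-∀
  arith′ : ∀ c l n → c * n * l ≡ c * (l * n)
  arith′ = solve-∀

archimedean : ∀ c .{{_ : NonZero c}} {δ} → 0ℚ ℚ.< δ → ∃[ l ] Σ[ l≢0 ∈ NonZero l ] (+ c / l) {{l≢0}} ℚ.≤ δ
archimedean c {mkℚ (+ zero) d _} (ℚ.*<* (ℤ.+<+ ()))
archimedean c {mkℚ (ℤ.-[1+ n ]) d _} (ℚ.*<* ())
-- For δ = (n + 1)/(d + 1) the choice l = c (d + 1) gives c/l = 1/(d + 1) ≤ δ.
archimedean c {δ@(mkℚ +[1+ n ] d _)} δ>0 = c * suc d , nz ,
  subst (((+ c / (c * suc d)) {{nz}}) ℚ.≤_) (ℚ.↥p/↧p≡p δ)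
    (/-≤-/ c (c * suc d) (suc n) (suc d) {{nz}} (ℕ.m≤m+n (c * suc d) (n * (c * suc d))))
  where
  nz : NonZero (c * suc d)
  nz = ℕ.m*n≢0 c (suc d)

half>0 : ∀ {ε} → 0ℚ ℚ.< ε → 0ℚ ℚ.< ½ ℚ.* ε
half>0 {ε} ε>0 = subst (ℚ._< ½ ℚ.* ε) (ℚ.*-zeroʳ ½) (ℚ.*-monoʳ-<-pos ½ ε>0)

half+half : ∀ ε → ½ ℚ.* ε ℚ.+ ½ ℚ.* ε ≡ ε
half+half ε = trans (sym (ℚ.*-distribʳ-+ ε ½ ½)) (ℚ.*-identityˡ ε)

p≤p+ε : ∀ p {ε} → 0ℚ ℚ.< ε → p ℚ.≤ p ℚ.+ ε
p≤p+ε p {ε} ε>0 = subst (ℚ._≤ p ℚ.+ ε) (ℚ.+-identityʳ p) (ℚ.+-monoʳ-≤ p (ℚ.<⇒≤ ε>0))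

p<p+ε : ∀ p {ε} → 0ℚ ℚ.< ε → p ℚ.< p ℚ.+ ε
p<p+ε p {ε} ε>0 = subst (ℚ._< p ℚ.+ ε) (ℚ.+-identityʳ p) (ℚ.+-monoʳ-< p ε>0)

p≤q+r⇒p-q≤r : ∀ p q r → p ℚ.≤ q ℚ.+ r → p ℚ.- q ℚ.≤ r
p≤q+r⇒p-q≤r p q r h = subst (p ℚ.- q ℚ.≤_) (arith q r) (ℚ.+-monoˡ-≤ (ℚ.- q) h)
  where
  open ℚ.+-*-Solver
  arith : ∀ q r → (q ℚ.+ r) ℚ.- q ≡ r
  arith = solve 2 (λ q r → (q :+ r) :- q := r) refl

p-q≤r⇒p≤q+r : ∀ p q r → p ℚ.- q ℚ.≤ r → p ℚ.≤ q ℚ.+ r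
p-q≤r⇒p≤q+r p q r h = subst (ℚ._≤ q ℚ.+ r) (arith p q) (ℚ.+-monoʳ-≤ q h)
  where
  open ℚ.+-*-Solver
  arith : ∀ p q → q ℚ.+ (p ℚ.- q) ≡ p
  arith = solve 2 (λ p q → q :+ (p :- q) := p) refl

∣p-q∣≤r : ∀ p q r → p ℚ.≤ q ℚ.+ r → q ℚ.≤ p ℚ.+ r → ℚ.∣ p ℚ.- q ∣ ℚ.≤ r
∣p-q∣≤r p q r h h′ with ℚ.∣p∣≡p∨∣p∣≡-p (p ℚ.- q)
... | inj₁ eq = subst (ℚ._≤ r) (sym eq) (p≤q+r⇒p-q≤r p q r h)
... | inj₂ eq = subst (ℚ._≤ r) (sym (trans eq (arith p q))) (p≤q+r⇒p-q≤r q p r h′)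
  where
  open ℚ.+-*-Solver
  arith : ∀ p q → ℚ.- (p ℚ.- q) ≡ q ℚ.- p
  arith = solve 2 (λ p q → :- (p :- q) := q :- p) refl

p≤∣p∣ : ∀ p → p ℚ.≤ ℚ.∣ p ∣
p≤∣p∣ p with ℚ.≤-total 0ℚ p
... | inj₁ 0≤p = ℚ.≤-reflexive (sym (ℚ.0≤p⇒∣p∣≡p 0≤p))
... | inj₂ p≤0 = ℚ.≤-trans p≤0 (ℚ.0≤∣p∣ p)

-- The order on ℝ

-- Both order relations on ℝ are rational inequalities holding eventually, so real arguments reduce
-- to rational ones at a common late stage.
Eventually : (ℕ → Set) → Set
Eventually P = ∃[ k ] ∀ n → k ℕ.≤ n → P n

infixl 4 _⊗_

_⊗_ : ∀ {P Q} → Eventually P → Eventually Q → Eventually (λ n → P n × Q n)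
(k , p) ⊗ (l , q) = k ℕ.⊔ l , λ n kl≤n → p n (ℕ.m⊔n≤o⇒m≤o k l kl≤n) , q n (ℕ.m⊔n≤o⇒n≤o k l kl≤n)

eventually-map : ∀ {P Q} → (∀ n → P n → Q n) → Eventually P → Eventually Q
eventually-map f (k , p) = k , λ n k≤n → f n (p n k≤n)

-- Finitely many thresholds have a maximum. This makes one threshold serve all distances s ≤ l².
eventually-∀< : ∀ {P : ℕ → ℕ → Set} → (∀ r → Eventually (P r)) → ∀ m → Eventually (λ n → ∀ r → r ℕ.< m → P r n)
eventually-∀< {P} ev zero    = 0 , λ n _ r ()
eventually-∀< {P} ev (suc m) = eventually-map step (ev m ⊗ eventually-∀< ev m)
  where
  step : ∀ n → P m n × (∀ r → r ℕ.< m → P r n) → ∀ r → r ℕ.< suc m → P r n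
  step n (Pm , P<m) r (s≤s r≤m) with ℕ.m≤n⇒m<n∨m≡n r≤m
  ... | inj₁ r<m  = P<m r r<m
  ... | inj₂ refl = Pm

<⇒≤ : ∀ {x y} → x < y → x ≤ y
<⇒≤ {x} {y} (ε′ , ε′>0 , x<y) ε ε>0 = eventually-map
  (λ n h → ℚ.≤-trans (p≤p+ε (seq x n) ε′>0) (ℚ.≤-trans h (p≤p+ε (seq y n) ε>0))) x<y

≤-trans : ∀ {x y z} → x ≤ y → y ≤ z → x ≤ z
≤-trans {x} {y} {z} x≤y y≤z ε ε>0 = eventually-map
  (λ n (h , h′) → ℚ.≤-trans h (ℚ.≤-trans (ℚ.+-monoˡ-≤ (½ ℚ.* ε) h′)
    (ℚ.≤-reflexive (trans (ℚ.+-assoc (seq z n) _ _) (cong (seq z n ℚ.+_) (half+half ε))))))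
  (x≤y (½ ℚ.* ε) (half>0 ε>0) ⊗ y≤z (½ ℚ.* ε) (half>0 ε>0))

≤-<-trans : ∀ {x y z} → x ≤ y → y < z → x < z
≤-<-trans {x} {y} {z} x≤y (ε , ε>0 , y<z) = ½ ℚ.* ε , half>0 ε>0 , eventually-map
  (λ n (h , h′) → ℚ.≤-trans (ℚ.+-monoˡ-≤ (½ ℚ.* ε) h) (ℚ.≤-trans
    (ℚ.≤-reflexive (trans (ℚ.+-assoc (seq y n) _ _) (cong (seq y n ℚ.+_) (half+half ε)))) h′))
  (x≤y (½ ℚ.* ε) (half>0 ε>0) ⊗ y<z)

<-≤-trans : ∀ {x y z} → x < y → y ≤ z → x < z
<-≤-trans {x} {y} {z} (ε , ε>0 , x<y) y≤z = ½ ℚ.* ε , half>0 ε>0 , eventually-map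
  (λ n (h , h′) → subst₂ ℚ._≤_
    (trans (cong (λ e → seq x n ℚ.+ e ℚ.- ½ ℚ.* ε) (sym (half+half ε))) (arith (seq x n) (½ ℚ.* ε)))
    (arith′ (seq z n) (½ ℚ.* ε))
    (ℚ.+-monoˡ-≤ (ℚ.- (½ ℚ.* ε)) (ℚ.≤-trans h h′)))
  (x<y ⊗ y≤z (½ ℚ.* ε) (half>0 ε>0))
  where
  open ℚ.+-*-Solver
  arith : ∀ p h → (p ℚ.+ (h ℚ.+ h)) ℚ.- h ≡ p ℚ.+ h
  arith = solve 2 (λ p h → (p :+ (h :+ h)) :- h := p :+ h) refl
  arith′ : ∀ p h → (p ℚ.+ h) ℚ.- h ≡ p
  arith′ = solve 2 (λ p h → (p :+ h) :- h := p) refl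

fromℚ-mono-< : ∀ {p q} → p ℚ.< q → fromℚ p < fromℚ q
fromℚ-mono-< {p} {q} p<q = q ℚ.- p ,
  subst (ℚ._< q ℚ.- p) (ℚ.+-inverseʳ p) (ℚ.+-monoˡ-< (ℚ.- p) p<q) ,
  0 , λ _ _ → ℚ.≤-reflexive (arith p q)
  where
  open ℚ.+-*-Solver
  arith : ∀ p q → p ℚ.+ (q ℚ.- p) ≡ q
  arith = solve 2 (λ p q → p :+ (q :- p) := q) refl

fromℚ-cancel-< : ∀ {p q} → fromℚ p < fromℚ q → p ℚ.< q
fromℚ-cancel-< {p} (ε , ε>0 , k , h) = ℚ.<-≤-trans (p<p+ε p ε>0) (h k ℕ.≤-refl)

-- If `seq x n + ε < q` at a single late `n`, the Cauchy property keeps `seq x m + ½ ε ≤ q` for all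
-- `m ≥ k`, which already witnesses `x < q`.
<∨≥ : ExcludedMiddle 0ℓ → ∀ x q → x < fromℚ q ⊎ fromℚ q ≤ x
<∨≥ em x q with em {x < fromℚ q}
... | yes x<q = inj₁ x<q
... | no  x≮q = inj₂ q≤x
  where
  q≤x : fromℚ q ≤ x
  q≤x ε ε>0 with cauchy x (½ ℚ.* ε) (half>0 ε>0)
  ... | k , close = k , λ n k≤n → ℚ.≮⇒≥ (λ xₙ+ε<q → x≮q (½ ℚ.* ε , half>0 ε>0 , k , λ m k≤m → begin
    seq x m ℚ.+ ½ ℚ.* ε
      ≤⟨ ℚ.+-monoˡ-≤ (½ ℚ.* ε) (p-q≤r⇒p≤q+r (seq x m) (seq x n) _
           (ℚ.≤-trans (p≤∣p∣ (seq x m ℚ.- seq x n)) (ℚ.<⇒≤ (close m n k≤m k≤n)))) ⟩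
    seq x n ℚ.+ ½ ℚ.* ε ℚ.+ ½ ℚ.* ε
      ≡⟨ trans (ℚ.+-assoc (seq x n) _ _) (cong (seq x n ℚ.+_) (half+half ε)) ⟩
    seq x n ℚ.+ ε
      ≤⟨ ℚ.<⇒≤ xₙ+ε<q ⟩
    q ∎))
    where open ℚ.≤-Reasoning

-- Grid cells of mesh 1/N

record Cell (N : ℕ) .{{_ : NonZero N}} (x : ℝ) : Set where
  field
    index   : ℕ
    lower   : fromℚ (+ index / N) ≤ x
    upper   : x < fromℚ (+ suc index / N)

  index≤N : x ≤ 1ℝ → index ℕ.≤ N
  index≤N x≤1 = ℕ.≮⇒≥ λ N<index → ℚ.<-irrefl refl (fromℚ-cancel-< (<-≤-trans {1ℝ} {fromℚ (+ index / N)} {1ℝ}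
    (fromℚ-mono-< (subst (ℚ._< + index / N) N/N≡1 (/-mono-< N N<index)))
    (≤-trans {fromℚ (+ index / N)} {x} {1ℝ} lower x≤1)))
    where
    N/N≡1 : + N / N ≡ 1ℚ
    N/N≡1 = /-≡-/ N N 1 1 (ℕ.*-comm N 1)

-- The search descends from `suc N`, where x ≤ 1 < (N + 1)/N, keeping `x < n / N`; it stops at the
-- first grid point not above `x`. The index is ⌊N x⌋, and equals `N` for x = 1.
cell : ExcludedMiddle 0ℓ → ∀ N .{{_ : NonZero N}} x → 0ℝ ≤ x → x ≤ 1ℝ → Cell N x
cell em N x 0≤x x≤1 = search (suc N) (≤-<-trans {x} {1ℝ} {fromℚ (+ suc N / N)} x≤1
  (fromℚ-mono-< (subst (ℚ._< + suc N / N) (/-≡-/ N N 1 1 (ℕ.*-comm N 1)) (/-mono-< N (ℕ.n<1+n N)))))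
  where
  search : ∀ n → x < fromℚ (+ n / N) → Cell N x
  search zero x<0 = ⊥-elim (ℚ.<-irrefl (/-≡-/ 0 1 0 N refl)
    (fromℚ-cancel-< (≤-<-trans {0ℝ} {x} {fromℚ (+ 0 / N)} 0≤x x<0)))
  search (suc n) x<n+1 with <∨≥ em x (+ n / N)
  ... | inj₁ x<n = search n x<n
  ... | inj₂ n≤x = record { index = n ; lower = n≤x ; upper = x<n+1 }

open Cell

module _ {N : ℕ} .{{_ : NonZero N}} where

  private
    cell-sep : ∀ {x y} (cx : Cell N x) (cy : Cell N y) {r} → index cx ℕ.≤ index cy + r → ∀ ε → 0ℚ ℚ.< ε →
      Eventually (λ n → seq x n ℚ.≤ seq y n ℚ.+ (+ suc r / N ℚ.+ ε))
    cell-sep {x} {y} cx cy {r} h ε ε>0 = eventually-map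
      (λ n (x≤ , ≤y) → begin
        seq x n
          ≤⟨ x≤ ⟩
        + suc (index cx) / N ℚ.+ ½ ℚ.* ε
          ≤⟨ ℚ.+-monoˡ-≤ (½ ℚ.* ε) (/-mono-≤ N (ℕ.≤-trans (s≤s h) (ℕ.≤-reflexive (sym (ℕ.+-suc (index cy) r))))) ⟩
        + (index cy + suc r) / N ℚ.+ ½ ℚ.* ε
          ≡⟨ cong (ℚ._+ ½ ℚ.* ε) (/-homo-+ (index cy) (suc r) N) ⟩
        + index cy / N ℚ.+ + suc r / N ℚ.+ ½ ℚ.* ε
          ≤⟨ ℚ.+-monoˡ-≤ (½ ℚ.* ε) (ℚ.+-monoˡ-≤ (+ suc r / N) ≤y) ⟩
        seq y n ℚ.+ ½ ℚ.* ε ℚ.+ + suc r / N ℚ.+ ½ ℚ.* ε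
          ≡⟨ arith (seq y n) (½ ℚ.* ε) (+ suc r / N) ⟩
        seq y n ℚ.+ (+ suc r / N ℚ.+ (½ ℚ.* ε ℚ.+ ½ ℚ.* ε))
          ≡⟨ cong (λ e → seq y n ℚ.+ (+ suc r / N ℚ.+ e)) (half+half ε) ⟩
        seq y n ℚ.+ (+ suc r / N ℚ.+ ε) ∎)
      (<⇒≤ {x} {fromℚ (+ suc (index cx) / N)} (upper cx) (½ ℚ.* ε) (half>0 ε>0) ⊗ lower cy (½ ℚ.* ε) (half>0 ε>0))
      where
      open ℚ.≤-Reasoning
      arith : ∀ y h r → y ℚ.+ h ℚ.+ r ℚ.+ h ≡ y ℚ.+ (r ℚ.+ (h ℚ.+ h))
      arith = solve 3 (λ y h r → y :+ h :+ r :+ h := y :+ (r :+ (h :+ h))) refl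
        where open ℚ.+-*-Solver

  -- The extra 1 in `suc r` is the width of one cell: x < (k + 1)/N ≤ (k′ + r + 1)/N ≤ y + (r + 1)/N
  -- for the indices k of `x` and k′ of `y`, and likewise with the two exchanged.
  cells-close : ∀ {x y} (cx : Cell N x) (cy : Cell N y) {r} → ℕ.∣ index cx - index cy ∣ ℕ.≤ r →
    ∣ x - y ∣ ≤ fromℚ (+ suc r / N)
  cells-close {x} {y} cx cy {r} h ε ε>0 = eventually-map
    (λ n (p , q) → ∣p-q∣≤r (seq x n) (seq y n) _ p q)
    (cell-sep cx cy (ℕ.≤-trans (ℕ.m≤n+∣m-n∣ (index cx) (index cy)) (ℕ.+-monoʳ-≤ (index cy) h)) ε ε>0 ⊗
     cell-sep cy cx (ℕ.≤-trans (ℕ.m≤n+∣n-m∣ (index cy) (index cx)) (ℕ.+-monoʳ-≤ (index cx) h)) ε ε>0)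

  cell-mono : ∀ {x y} (cx : Cell N x) (cy : Cell N y) → x ≤ y → index cx ℕ.≤ index cy
  cell-mono {x} {y} cx cy x≤y = ℕ.s≤s⁻¹ (/-cancel-< N (fromℚ-cancel-<
    (≤-<-trans {fromℚ (+ index cx / N)} {x} {fromℚ (+ suc (index cy) / N)} (lower cx)
      (≤-<-trans {x} {y} {fromℚ (+ suc (index cy) / N)} x≤y (upper cy)))))

  -- The upper end of the cell of `x` is at most the lower end of the cell of `y`, and a cell
  -- excludes its upper end.
  cell-reflects-< : ∀ {x y} (cx : Cell N x) (cy : Cell N y) → index cx ℕ.< index cy → x < y
  cell-reflects-< {x} {y} cx cy h =
    <-≤-trans {x} {fromℚ (+ suc (index cx) / N)} {y} (upper cx)
      (≤-trans {fromℚ (+ suc (index cx) / N)} {fromℚ (+ index cy / N)} {y}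
        (λ ε ε>0 → 0 , λ _ _ → ℚ.≤-trans (/-mono-≤ N h) (p≤p+ε _ ε>0)) (lower cy))

-- Interval membership and the bound on close pairs

∈⇒≥left : ∀ {t} J → t ∈ J → Interval.left J ≤ t
∈⇒≥left {t} J (l≤t , _) with Interval.leftKind J
... | closedEnd = l≤t
... | openEnd   = <⇒≤ {Interval.left J} {t} l≤t

∈⇒≤right : ∀ {t} J → t ∈ J → t ≤ Interval.right J
∈⇒≤right {t} J (_ , t≤r) with Interval.rightKind J
... | closedEnd = t≤r
... | openEnd   = <⇒≤ {t} {Interval.right J} t≤r

<-interior⇒∈ : ∀ {t} J → Interval.left J < t → t < Interval.right J → t ∈ J
<-interior⇒∈ {t} J l<t t<r = atLeft (Interval.leftKind J) , atRight (Interval.rightKind J)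
  where
  atLeft : ∀ kind → Interval.left J ≤[ kind ] t
  atLeft closedEnd = <⇒≤ {Interval.left J} {t} l<t
  atLeft openEnd   = l<t
  atRight : ∀ kind → t ≤[ kind ] Interval.right J
  atRight closedEnd = <⇒≤ {t} {Interval.right J} t<r
  atRight openEnd   = t<r

-- The reals involved are constant sequences, so the hypothesis can be read at the single stage `k`:
-- there c/N - 2s ≤ 1.
near⇒≤ : ∀ c N s .{{_ : NonZero N}} →
  ∣ fromℚ (+ c / N) - fromℚ (+ (2 * s) / 1) ∣ < 1ℝ → c ℕ.≤ N * (2 * s + 1)
near⇒≤ c N s (ε , ε>0 , k , h) = subst₂ ℕ._≤_ (ℕ.*-identityʳ c) (ℕ.*-comm (2 * s + 1) N)
  (/-≤-/⁻¹ c N (2 * s + 1) 1 (subst (+ c / N ℚ.≤_) (sym (/-homo-+ (2 * s) 1 1))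
    (p-q≤r⇒p≤q+r (+ c / N) (+ (2 * s) / 1) 1ℚ (ℚ.≤-trans (p≤∣p∣ D) (ℚ.≤-trans (p≤p+ε ℚ.∣ D ∣ ε>0) (h k ℕ.≤-refl))))))
  where D = + c / N ℚ.- + (2 * s) / 1

-- Visits to an interval compared with its length

module _ (em : ExcludedMiddle 0ℓ) (x : ℕ → ℝ) (x∈[0,1] : ∀ n → 0ℝ ≤ x n × x n ≤ 1ℝ) where

  module _ (l : ℕ) .{{_ : NonZero l}} (N : ℕ) .{{_ : NonZero N}} (l⁴≤N : l * l * (l * l) ℕ.≤ N)
    (pairs : ∀ r → r ℕ.< l * l → #closePairs em x N (fromℚ (+ suc r / N)) ℕ.≤ N * (2 * suc r + 1))
    (J : Interval) where

    open Interval J hiding (len)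

    private
      V : ℕ
      V = #visits em x N J

      point : ∀ i → Cell N (x i)
      point i = cell em N (x i) (proj₁ (x∈[0,1] i)) (proj₂ (x∈[0,1] i))

      leftCell : Cell N left
      leftCell = cell em N left 0≤left (≤-trans {left} {right} {1ℝ} left≤right right≤1)

      rightCell : Cell N right
      rightCell = cell em N right (≤-trans {0ℝ} {left} {right} 0≤left left≤right) right≤1

      a b : ℕ
      a = index leftCell
      b = index rightCell

      v : Fin N → ℕ
      v i = ⟦ em {x (toℕ i) ∈ J} ⟧

      V≡sum : V ≡ sum v
      V≡sum = count-tabulate em (λ i → x (toℕ i) ∈ J) {N} id

      open IntervalCounts {N} l l⁴≤N (λ i → index (point (toℕ i))) (λ i → index≤N (point (toℕ i)) (proj₂ (x∈[0,1] (toℕ i))))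

      -- By `cells-close` each close pair of cells is a close pair of points, so the hypothesis on
      -- `#closePairs` transfers to the cells.
      closeCells : ∀ (r : Fin (l * l)) → ∑[ i < N ] ∑[ j < N ] close (toℕ r) i j ℕ.≤ N * (2 * (1 + toℕ r) + 1)
      closeCells r = ℕ.≤-trans
        (sum-mono-≤ {N} λ i → sum-mono-≤ {N} λ j → ⟦⟧-mono
          (¬? (i Fin.≟ j) ×-dec (ℕ.∣ index (point (toℕ i)) - index (point (toℕ j)) ∣ ℕ.≤? toℕ r)) em
          (λ (i≢j , h) → i≢j , cells-close (point (toℕ i)) (point (toℕ j)) h))
        (ℕ.≤-trans
          (ℕ.≤-reflexive (sym (count-cartesianProduct em
            (λ (i , j) → i ≢ j × ∣ x (toℕ i) - x (toℕ j) ∣ ≤ fromℚ (+ suc (toℕ r) / N)) {N} {N} id id)))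
          (pairs (toℕ r) (Fin.toℕ<n r)))

      a≤b : a ℕ.≤ b
      a≤b = cell-mono leftCell rightCell left≤right

      visits-upper : + (V + a + 1) / N ℚ.≤ + b / N ℚ.+ + 5 / l
      visits-upper = /-≤-+-/ (V + a + 1) b 5 l N (subst (λ u → l * (u + a + 1) ℕ.≤ l * b + 5 * N) (sym V≡sum)
        (count-upper closeCells a b a≤b (index≤N rightCell right≤1) v (λ i → ⟦⟧≡0∨1 em)
          -- Membership implies weak inequalities between cell indices, whichever kind the endpoints
          -- are.
          (λ i v≡1 → let x∈J = ⟦⟧≡1⇒ em v≡1 in
            cell-mono leftCell (point (toℕ i)) (∈⇒≥left J x∈J) ,
            cell-mono (point (toℕ i)) rightCell (∈⇒≤right J x∈J))))

      visits-lower : + (b + 1) / N ℚ.≤ + (V + a) / N ℚ.+ + 5 / l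
      visits-lower = /-≤-+-/ (b + 1) (V + a) 5 l N (subst (λ u → l * (b + 1) ℕ.≤ l * (u + a) + 5 * N) (sym V≡sum)
        (count-lower closeCells a b a≤b (index≤N rightCell right≤1) v (λ i → ⟦⟧≡0∨1 em)
          -- Strict inequalities between cell indices place the point strictly inside `J`, which
          -- meets either kind of endpoint condition.
          (λ i a<k k<b → ⟦⟧-yes em (<-interior⇒∈ J
            (cell-reflects-< leftCell (point (toℕ i)) a<k) (cell-reflects-< (point (toℕ i)) rightCell k<b)))))

    -- At late stages the approximations of the endpoints lie within δ of their cells. The `+ 1` in
    -- `visits-upper` allows for the left endpoint near (a + 1)/N, the one in `visits-lower` for the
    -- right endpoint near (b + 1)/N.
    visits≈len : ∀ δ → 0ℚ ℚ.< δ → Eventually (λ n →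
      ℚ.∣ + V / N ℚ.- seq (len J) n ∣ ℚ.≤ + 5 / l ℚ.+ (δ ℚ.+ δ))
    visits≈len δ δ>0 = eventually-map
      (λ n (((a≤L , L≤a) , b≤R) , R≤b) → ∣p-q∣≤r (+ V / N) (seq right n ℚ.- seq left n) _
        (V≤ (seq left n) (seq right n) L≤a b≤R)
        (≤V (seq left n) (seq right n) a≤L R≤b))
      (lower leftCell δ δ>0 ⊗ <⇒≤ {left} {fromℚ (+ suc a / N)} (upper leftCell) δ δ>0 ⊗
       lower rightCell δ δ>0 ⊗ <⇒≤ {right} {fromℚ (+ suc b / N)} (upper rightCell) δ δ>0)
      where
      open ℚ.≤-Reasoning
      D = + 5 / l
      module _ (L R : ℚ) where
        open ℚ.+-*-Solver
        arith₁ : ∀ v L → v ≡ v ℚ.+ L ℚ.- L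
        arith₁ = solve 2 (λ v L → v := v :+ L :- L) refl
        arith₂ : ∀ v a δ L → v ℚ.+ (a ℚ.+ δ) ℚ.- L ≡ (v ℚ.+ a) ℚ.+ (δ ℚ.- L)
        arith₂ = solve 4 (λ v a δ L → v :+ (a :+ δ) :- L := (v :+ a) :+ (δ :- L)) refl
        arith₃ : ∀ R δ D L → R ℚ.+ δ ℚ.+ D ℚ.+ (δ ℚ.- L) ≡ (R ℚ.- L) ℚ.+ (D ℚ.+ (δ ℚ.+ δ))
        arith₃ = solve 4 (λ R δ D L → R :+ δ :+ D :+ (δ :- L) := (R :- L) :+ (D :+ (δ :+ δ))) refl
        arith₄ : ∀ v L δ D → v ℚ.+ (L ℚ.+ δ) ℚ.+ D ℚ.+ δ ℚ.- L ≡ v ℚ.+ (D ℚ.+ (δ ℚ.+ δ))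
        arith₄ = solve 4 (λ v L δ D → v :+ (L :+ δ) :+ D :+ δ :- L := v :+ (D :+ (δ :+ δ))) refl

        V≤ : L ℚ.≤ + suc a / N ℚ.+ δ → + b / N ℚ.≤ R ℚ.+ δ →
          + V / N ℚ.≤ (R ℚ.- L) ℚ.+ (D ℚ.+ (δ ℚ.+ δ))
        V≤ L≤a b≤R = begin
          + V / N                                    ≡⟨ arith₁ (+ V / N) L ⟩
          + V / N ℚ.+ L ℚ.- L                        ≤⟨ ℚ.+-monoˡ-≤ (ℚ.- L) (ℚ.+-monoʳ-≤ (+ V / N) L≤a) ⟩
          + V / N ℚ.+ (+ suc a / N ℚ.+ δ) ℚ.- L      ≡⟨ arith₂ (+ V / N) (+ suc a / N) δ L ⟩
          + V / N ℚ.+ + suc a / N ℚ.+ (δ ℚ.- L)      ≡⟨ cong (ℚ._+ (δ ℚ.- L)) (/-homo-+ V (suc a) N) ⟨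
          + (V + suc a) / N ℚ.+ (δ ℚ.- L)            ≡⟨ cong (λ u → + u / N ℚ.+ (δ ℚ.- L)) (trans (ℕ.+-suc V a) (ℕ.+-comm 1 (V + a))) ⟩
          + (V + a + 1) / N ℚ.+ (δ ℚ.- L)            ≤⟨ ℚ.+-monoˡ-≤ (δ ℚ.- L) visits-upper ⟩
          + b / N ℚ.+ D ℚ.+ (δ ℚ.- L)                ≤⟨ ℚ.+-monoˡ-≤ (δ ℚ.- L) (ℚ.+-monoˡ-≤ D b≤R) ⟩
          R ℚ.+ δ ℚ.+ D ℚ.+ (δ ℚ.- L)                ≡⟨ arith₃ R δ D L ⟩
          (R ℚ.- L) ℚ.+ (D ℚ.+ (δ ℚ.+ δ))            ∎

        ≤V : + a / N ℚ.≤ L ℚ.+ δ → R ℚ.≤ + suc b / N ℚ.+ δ →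
          R ℚ.- L ℚ.≤ + V / N ℚ.+ (D ℚ.+ (δ ℚ.+ δ))
        ≤V a≤L R≤b = begin
          R ℚ.- L                                          ≤⟨ ℚ.+-monoˡ-≤ (ℚ.- L) R≤b ⟩
          + suc b / N ℚ.+ δ ℚ.- L                          ≡⟨ cong (λ u → + u / N ℚ.+ δ ℚ.- L) (ℕ.+-comm 1 b) ⟩
          + (b + 1) / N ℚ.+ δ ℚ.- L                        ≤⟨ ℚ.+-monoˡ-≤ (ℚ.- L) (ℚ.+-monoˡ-≤ δ visits-lower) ⟩
          + (V + a) / N ℚ.+ D ℚ.+ δ ℚ.- L                  ≡⟨ cong (λ u → u ℚ.+ D ℚ.+ δ ℚ.- L) (/-homo-+ V a N) ⟩
          + V / N ℚ.+ + a / N ℚ.+ D ℚ.+ δ ℚ.- L            ≤⟨ ℚ.+-monoˡ-≤ (ℚ.- L) (ℚ.+-monoˡ-≤ δ (ℚ.+-monoˡ-≤ D (ℚ.+-monoʳ-≤ (+ V / N) a≤L))) ⟩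
          + V / N ℚ.+ (L ℚ.+ δ) ℚ.+ D ℚ.+ δ ℚ.- L          ≡⟨ arith₄ (+ V / N) L δ D ⟩
          + V / N ℚ.+ (D ℚ.+ (δ ℚ.+ δ))                    ∎

-- Passage to the limit

eventually-closePairs-≤ : (em : ExcludedMiddle 0ℓ) (x : ℕ → ℝ) →
  (∀ (s : ℕ) .{{_ : NonZero s}} →
    Lim (λ N → fromℚ (+ #closePairs em x N (fromℚ (+ s / N)) / N)) (fromℚ (+ (2 * s) / 1))) →
  ∀ m → Eventually (λ N → ∀ r → r ℕ.< m → .{{_ : NonZero N}} →
    #closePairs em x N (fromℚ (+ suc r / N)) ℕ.≤ N * (2 * suc r + 1))
eventually-closePairs-≤ em x pairCorrelation = eventually-∀<
  {P = λ r N → .{{_ : NonZero N}} → #closePairs em x N (fromℚ (+ suc r / N)) ℕ.≤ N * (2 * suc r + 1)}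
  -- Tolerance 1 is enough: over all `r < S` it adds only N S to the second moment, against the main
  -- term N S².
  (λ r → let (N₀ , h) = pairCorrelation (suc r) 1ℝ (fromℚ-mono-< (ℚ.positive⁻¹ 1ℚ)) in
    N₀ , λ N N₀≤N → near⇒≤ (#closePairs em x N (fromℚ (+ suc r / N))) N (suc r) (h N N₀≤N))

quarters : ∀ e → let δ = ½ ℚ.* (½ ℚ.* e) in δ ℚ.+ (δ ℚ.+ δ) ℚ.+ δ ≡ e
quarters e = trans (arith (½ ℚ.* (½ ℚ.* e)))
  (trans (cong₂ ℚ._+_ (half+half (½ ℚ.* e)) (half+half (½ ℚ.* e))) (half+half e))
  where
  open ℚ.+-*-Solver
  arith : ∀ d → d ℚ.+ (d ℚ.+ d) ℚ.+ d ≡ (d ℚ.+ d) ℚ.+ (d ℚ.+ d)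
  arith = solve 1 (λ d → d :+ (d :+ d) :+ d := (d :+ d) :+ (d :+ d)) refl

corollary3 : (em : ExcludedMiddle 0ℓ) (x : ℕ → ℝ) →
    (∀ n → 0ℝ ≤ x n × x n ≤ 1ℝ) →
    (∀ (s : ℕ) .{{_ : NonZero s}} →
    Lim (λ N → fromℚ (+ #closePairs em x N (fromℚ (+ s / N)) / N))
    (fromℚ (+ (2 * s) / 1))) →
    UniformlyDistributed em x
corollary3 em x x∈[0,1] pairCorrelation J ε (e , e>0 , k , e≤ε) =
  conclude (archimedean 5 δ>0)
  where
  -- A quarter of the rational `e` that witnesses `0ℝ < ε`: one quarter bounds 5/l, two cover the
  -- endpoint approximations, and the last is the gap required by the strict inequality.
  δ : ℚ
  δ = ½ ℚ.* (½ ℚ.* e)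

  δ>0 : 0ℚ ℚ.< δ
  δ>0 = half>0 (half>0 e>0)

  combine : ∀ {d p q} → d ℚ.≤ δ → p ℚ.≤ d ℚ.+ (δ ℚ.+ δ) → 0ℚ ℚ.+ e ℚ.≤ q → p ℚ.+ δ ℚ.≤ q
  combine {d} {p} {q} d≤δ p≤ e≤q = begin
    p ℚ.+ δ                    ≤⟨ ℚ.+-monoˡ-≤ δ p≤ ⟩
    d ℚ.+ (δ ℚ.+ δ) ℚ.+ δ      ≤⟨ ℚ.+-monoˡ-≤ δ (ℚ.+-monoˡ-≤ (δ ℚ.+ δ) d≤δ) ⟩
    δ ℚ.+ (δ ℚ.+ δ) ℚ.+ δ      ≡⟨ quarters e ⟩
    e                          ≡⟨ ℚ.+-identityˡ e ⟨
    0ℚ ℚ.+ e                   ≤⟨ e≤q ⟩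
    q                          ∎
    where open ℚ.≤-Reasoning

  conclude : ∃[ l ] Σ[ l≢0 ∈ NonZero l ] (+ 5 / l) {{l≢0}} ℚ.≤ δ →
    ∃[ N₀ ] ∀ N .{{_ : NonZero N}} → N₀ ℕ.≤ N → ∣ fromℚ (+ #visits em x N J / N) - len J ∣ < ε
  -- Beyond `N₁` the pair bounds hold for all s ≤ l²; the other threshold is the condition l⁴ ≤ N of
  -- the counting argument.
  conclude (l , l≢0 , 5/l≤δ) = N₁ ℕ.⊔ l * l * (l * l) , λ N N₀≤N → δ , δ>0 , eventually-map
    (λ n (h , e≤εₙ) → combine 5/l≤δ h e≤εₙ)
    (visits≈len em x x∈[0,1] l {{l≢0}} N (ℕ.m⊔n≤o⇒n≤o N₁ (l * l * (l * l)) N₀≤N)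
       (λ r r<l² → closePairs-≤ N (ℕ.m⊔n≤o⇒m≤o N₁ (l * l * (l * l)) N₀≤N) r r<l²) J δ δ>0
     ⊗ (k , e≤ε))
    where
    eventually = eventually-closePairs-≤ em x pairCorrelation (l * l)
    N₁ = proj₁ eventually
    closePairs-≤ = proj₂ eventually
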